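{- Let $V_3\subset\mathbb{F}_3^4$ be a $3$-dimensional subspace such that the plane $\mathbb{P}V_3\subset\operatorname{PG}(3,3)$ contains exactly three of the four points $\langle1000\rangle,\langle0100\rangle,\langle0010\rangle,\langle0001\rangle$ (kind $\mathcal{C}_3$), let $H=\{A_\lambda:\lambda\in V_3\}$, and let $\mathcal{R}$ be any one of $\mathcal{R}_H,\mathcal{R}'_H,\mathcal{R}''_H$. Then the span $\langle\mathcal{R}\rangle$ is a $6$-dimensional projective subspace ($6$-flat, i.e. hyperplane) of $\operatorname{PG}(7,2)$.
   Context: Work over $\mathbb{F}_2$. $V_8=V(8,2)$ with basis $e_1,\dots,e_8$, $V_a=\langle e_1,e_8\rangle$, $V_b=\langle e_2,e_7\rangle$, $V_c=\langle e_3,e_6\rangle$, $V_d=\langle e_4,e_5\rangle$; points of $\operatorname{PG}(7,2)$ are nonzero vectors; $\omega_4$ is the set of vectors all four of whose components in $V_a,\dots,V_d$ are nonzero. Let $\zeta_a: e_1\mapsto e_8\mapsto e_1+e_8\mapsto e_1$, $\zeta_b: e_7\mapsto e_2\mapsto e_2+e_7\mapsto e_7$, $\zeta_c: e_3\mapsto e_6\mapsto e_3+e_6\mapsto e_3$, $\zeta_d: e_5\mapsto e_4\mapsto e_4+e_5\mapsto e_5$. For $\lambda=ijkl\in\mathbb{F}_3^4$ let $A_\lambda=\zeta_a^i\oplus\zeta_b^j\oplus\zeta_c^k\oplus\zeta_d^l$; these form a group $\mathcal{G}_{81}\cong(Z_3)^4$. Let $u=e_1+\dots+e_8$. For a subgroup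 $H\cong(Z_3)^3$ of $\mathcal{G}_{81}$ with cosets $H,H',H''$, set $\mathcal{R}_H=\{hu:h\in H\}$, $\mathcal{R}'_H=\{hu:h\in H'\}$, $\mathcal{R}''_H=\{hu:h\in H''\}$ (27-subsets of $\omega_4$). -}

module Defs where

open import Data.Bool using (Bool; true; false; _xor_; _∧_)
open import Data.Nat using (ℕ; zero; suc)
open import Data.Fin using (Fin; zero; suc; toℕ)
open import Data.Vec using (Vec; []; _∷_; zipWith; replicate; map; lookup)
open import Data.List using (List; foldr)
open import Data.List.Relation.Unary.All using (All)
open import Data.Product using (Σ; ∃; _×_; _,_)
open import Relation.Binary.PropositionalEquality using (_≡_; _≢_)
open import Relation.Nullary using (¬_)

V : ℕ → Set
V n = Vec Bool n

0v : ∀ {n} → V n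
0v = replicate _ false

_⊕_ : ∀ {n} → V n → V n → V n
_⊕_ = zipWith _xor_

infixl 6 _⊕_

_·_ : ∀ {n} → Bool → V n → V n
c · x = map (c ∧_) x

sumL : ∀ {n} → List (V n) → V n
sumL = foldr _⊕_ 0v

lincomb : ∀ {n k} → Vec Bool k → (Fin k → V n) → V n
lincomb [] b = 0v
lincomb (c ∷ cs) b = (c · b zero) ⊕ lincomb cs (λ i → b (suc i))

-- F₂-span of a set of vectors (given as a predicate): all finite sums of
-- elements of the set (over F₂ coefficients are 0/1).
Span : ∀ {n} → (V n → Set) → V n → Set
Span {n} P w = Σ (List (V n)) λ xs → All P xs × (w ≡ sumL xs)

LinIndep : ∀ {n k} → (Fin k → V n) → Set
LinIndep {n} {k} b = (c : Vec Bool k) → lincomb c b ≡ 0v → c ≡ replicate k false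

SpanHasDim : ∀ {n} → (V n → Set) → ℕ → Set
SpanHasDim {n} P d =
  Σ (Fin d → V n) λ b →
    LinIndep b × ((w : V n) → (Span P w → ∃ λ c → w ≡ lincomb c b)
                            × ((∃ λ c → w ≡ lincomb c b) → Span P w))

IsProjFlat : ∀ {n} → (V n → Set) → ℕ → Set
IsProjFlat P m = SpanHasDim P (suc m)

-- V₈ with basis e₁..e₈ ; e (i) for i : Fin 8 is e_{i+1}

V8 : Set
V8 = V 8

e : Fin 8 → V8
e i = Data.Vec.updateAt (replicate 8 false) i (λ _ → true)

linExt : (Fin 8 → V8) → V8 → V8
linExt img x = lincomb x img

ι1 ι2 ι3 ι4 ι5 ι6 ι7 ι8 : Fin 8
ι1 = zero
ι2 = suc zero
ι3 = suc (suc zero)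
ι4 = suc (suc (suc zero))
ι5 = suc (suc (suc (suc zero)))
ι6 = suc (suc (suc (suc (suc zero))))
ι7 = suc (suc (suc (suc (suc (suc zero)))))
ι8 = suc (suc (suc (suc (suc (suc (suc zero))))))

-- ζ_a, ζ_b, ζ_c, ζ_d, each acting on its block and as identity on the
-- other blocks (so ζ_a^i ⊕ ζ_b^j ⊕ ζ_c^k ⊕ ζ_d^l is their composite).
-- ζ_a : e1 ↦ e8 ↦ e1+e8 ↦ e1
ζa : V8 → V8
ζa = linExt img
  where
  img : Fin 8 → V8
  img zero = e ι8
  img (suc (suc (suc (suc (suc (suc (suc zero))))))) = e ι1 ⊕ e ι8
  img i = e i

ζb : V8 → V8
ζb = linExt img
  where
  img : Fin 8 → V8
  img (suc zero) = e ι2 ⊕ e ι7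
  img (suc (suc (suc (suc (suc (suc zero)))))) = e ι2
  img i = e i

ζc : V8 → V8
ζc = linExt img
  where
  img : Fin 8 → V8
  img (suc (suc zero)) = e ι6
  img (suc (suc (suc (suc (suc zero))))) = e ι3 ⊕ e ι6
  img i = e i

ζd : V8 → V8
ζd = linExt img
  where
  img : Fin 8 → V8
  img (suc (suc (suc zero))) = e ι4 ⊕ e ι5
  img (suc (suc (suc (suc zero)))) = e ι4
  img i = e i

iter : {A : Set} → ℕ → (A → A) → A → A
iter zero f x = x
iter (suc n) f x = f (iter n f x)

F3 : Set
F3 = Fin 3

_+₃_ : F3 → F3 → F3
zero +₃ y = y
suc zero +₃ zero = suc zero
suc zero +₃ suc zero = suc (suc zero)
suc zero +₃ suc (suc zero) = zero
suc (suc zero) +₃ zero = suc (suc zero)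
suc (suc zero) +₃ suc zero = zero
suc (suc zero) +₃ suc (suc zero) = suc zero

_*₃_ : F3 → F3 → F3
zero *₃ y = zero
suc zero *₃ y = y
suc (suc zero) *₃ y = y +₃ y

F3⁴ : Set
F3⁴ = Vec F3 4

_+v_ : F3⁴ → F3⁴ → F3⁴
_+v_ = zipWith _+₃_

_*v_ : F3 → F3⁴ → F3⁴
a *v x = map (a *₃_) x

0₃ : F3⁴
0₃ = replicate 4 zero

ε : Fin 4 → F3⁴
ε i = Data.Vec.updateAt 0₃ i (λ _ → suc zero)

SpanF3 : F3⁴ → F3⁴ → F3⁴ → F3⁴ → Set
SpanF3 v₁ v₂ v₃ x = Σ F3 λ a → Σ F3 λ b → Σ F3 λ c →
  x ≡ (a *v v₁) +v ((b *v v₂) +v (c *v v₃))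

Indep3 : F3⁴ → F3⁴ → F3⁴ → Set
Indep3 v₁ v₂ v₃ = (a b c : F3) →
  (a *v v₁) +v ((b *v v₂) +v (c *v v₃)) ≡ 0₃ → (a ≡ zero) × (b ≡ zero) × (c ≡ zero)

ExactlyThreeStdPoints : (F3⁴ → Set) → Set
ExactlyThreeStdPoints W = Σ (Fin 4) λ i → ¬ W (ε i) × ((j : Fin 4) → j ≢ i → W (ε j))

-- A_λ = ζ_a^i ⊕ ζ_b^j ⊕ ζ_c^k ⊕ ζ_d^l for λ = ijkl

A : F3⁴ → V8 → V8
A (i ∷ j ∷ k ∷ l ∷ []) x =
  iter (toℕ i) ζa (iter (toℕ j) ζb (iter (toℕ k) ζc (iter (toℕ l) ζd x)))

u : V8
u = replicate 8 true

-- For H = {A_λ : λ ∈ W} and the coset A_μ H, the set {h u : h ∈ A_μ H}.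
-- (μ = 0 gives R_H; the cosets H', H'' are A_μ H for suitable μ.)
RCoset : (F3⁴ → Set) → F3⁴ → V8 → Set
RCoset W μ w = Σ F3⁴ λ λ' → W λ' × (w ≡ A μ (A λ' u))

{-# OPTIONS --safe #-}

-- Since W is a subspace containing ε j for all j ≢ i but not ε i, it is the
-- coordinate hyperplane λᵢ = 0. Among the points A λ u with λ ∈ W, the seven
-- with λ supported on at most one coordinate (u itself, and ζⱼ u, ζⱼ² u for
-- the three j ≢ i) are linearly independent, and every other one is an
-- affine combination of them, as A λ u + u = Σⱼ (ζⱼ^λⱼ u + u). Passing to a
-- coset applies the linear map A μ, which is injective because each ζ has
-- order 3.

module Submission where

open import Defs
open import Algebra.Definitions using (Interchangable)
open import Data.Bool using (Bool; true; false; _xor_)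
import Data.Bool.Properties as Bool
open import Data.Fin using (Fin; zero; suc; toℕ; punchIn; remQuot; _≟_)
open import Data.Fin.Properties using (all?; punchInᵢ≢i)
open import Data.List using ([]; _∷_)
open import Data.List.Relation.Unary.All using ([]; _∷_)
open import Data.Nat using (zero; suc)
open import Data.Product using (∃; _,_)
open import Data.Sum using (_⊎_; fromInj₂)
open import Data.Vec using (Vec; []; _∷_; zipWith; lookup; tabulate; foldr′)
open import Data.Vec.Properties using (≡-dec; zipWith-identityˡ)
open import Function using (_∘_; id; flip)
open import Relation.Binary.PropositionalEquality
open import Relation.Nullary using (¬_; Dec; yes; no; does; contradiction)
open import Relation.Nullary.Decidable using (map′; toWitness; _→-dec_; _×-dec_; _⊎-dec_)
open import Relation.Unary using (Decidable)

open ≡-Reasoning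

-- Closed statements over finite types are proved below by evaluating such a decision and extracting
-- its proof with `toWitness`.
Exhaustible : Set → Set₁
Exhaustible X = {P : X → Set} → Decidable P → Dec (∀ x → P x)

allBool? : Exhaustible Bool
allBool? P? = map′ (λ { (f , t) false → f ; (f , t) true → t })
                   (λ p → p false , p true)
                   (P? false ×-dec P? true)

allVec? : ∀ {X} → Exhaustible X → ∀ n → Exhaustible (Vec X n)
allVec? all zero    P? = map′ (λ { p [] → p }) (λ p → p []) (P? [])
allVec? all (suc n) P? =
  map′ (λ { p (x ∷ xs) → p x xs }) (λ p x xs → p (x ∷ xs))
       (all λ x → allVec? all n λ xs → P? (x ∷ xs))

_≟V_ : ∀ {n} (x y : V n) → Dec (x ≡ y)
_≟V_ = ≡-dec Bool._≟_

_≟F3⁴_ : (x y : F3⁴) → Dec (x ≡ y)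
_≟F3⁴_ = ≡-dec _≟_

allV? : ∀ n → Exhaustible (V n)
allV? = allVec? allBool?

allF3⁴? : Exhaustible F3⁴
allF3⁴? = allVec? all? 4

-- Leaves the law to be checked on single entries only, where search is cheap; serves both `_⊕_` and
-- `_+v_`.
zipWith-interchange : ∀ {X : Set} {f : X → X → X} → Interchangable _≡_ f f →
  ∀ {n} → Interchangable _≡_ (zipWith {n = n} f) (zipWith f)
zipWith-interchange f-int [] [] [] [] = refl
zipWith-interchange f-int (w ∷ ws) (x ∷ xs) (y ∷ ys) (z ∷ zs) =
  cong₂ _∷_ (f-int w x y z) (zipWith-interchange f-int ws xs ys zs)

-- Linear algebra over F₂

⊕-interchange : ∀ {n} → Interchangable _≡_ (_⊕_ {n}) _⊕_
⊕-interchange = zipWith-interchange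
  (toWitness {a? = allBool? λ w → allBool? λ x → allBool? λ y → allBool? λ z →
                     ((w xor x) xor (y xor z)) Bool.≟ ((w xor y) xor (x xor z))} _)

⊕-identityˡ : ∀ {n} (x : V n) → 0v ⊕ x ≡ x
⊕-identityˡ = zipWith-identityˡ Bool.xor-identityˡ

⊕-self : ∀ {n} (x : V n) → x ⊕ x ≡ 0v
⊕-self []       = refl
⊕-self (x ∷ xs) = cong₂ _∷_ (Bool.xor-same x) (⊕-self xs)

false· : ∀ {n} (x : V n) → false · x ≡ 0v
false· []       = refl
false· (x ∷ xs) = cong (false ∷_) (false· xs)

true· : ∀ {n} (x : V n) → true · x ≡ x
true· []       = refl
true· (x ∷ xs) = cong (x ∷_) (true· xs)

xor-· : ∀ {n} (c d : Bool) (x : V n) → (c xor d) · x ≡ c · x ⊕ d · x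
xor-· c d []       = refl
xor-· c d (x ∷ xs) = cong₂ _∷_ (Bool.∧-distribʳ-xor x c d) (xor-· c d xs)

lincomb-⊕ : ∀ {n k} (c d : Vec Bool k) (b : Fin k → V n) →
  lincomb (c ⊕ d) b ≡ lincomb c b ⊕ lincomb d b
lincomb-⊕ [] [] b = sym (⊕-self 0v)
lincomb-⊕ (c ∷ cs) (d ∷ ds) b =
  trans (cong₂ _⊕_ (xor-· c d (b zero)) (lincomb-⊕ cs ds (b ∘ suc)))
        (⊕-interchange (c · b zero) (d · b zero) (lincomb cs (b ∘ suc)) (lincomb ds (b ∘ suc)))

lincomb-0v : ∀ {n k} (b : Fin k → V n) → lincomb 0v b ≡ 0v
lincomb-0v {k = zero}  b = refl
lincomb-0v {k = suc k} b =
  trans (cong₂ _⊕_ (false· (b zero)) (lincomb-0v (b ∘ suc))) (⊕-self 0v)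

-- Over F₂ this already amounts to linearity, since the only scalars are 0 and 1.
Additive : ∀ {m n} → (V m → V n) → Set
Additive f = ∀ x y → f (x ⊕ y) ≡ f x ⊕ f y

module _ {m n} {f : V m → V n} (f-⊕ : Additive f) where

  additive-0v : f 0v ≡ 0v
  additive-0v = begin
    f 0v           ≡⟨ cong f (⊕-self 0v) ⟨
    f (0v ⊕ 0v)    ≡⟨ f-⊕ 0v 0v ⟩
    f 0v ⊕ f 0v    ≡⟨ ⊕-self (f 0v) ⟩
    0v             ∎

  additive-· : ∀ c x → f (c · x) ≡ c · f x
  additive-· false x = trans (cong f (false· x)) (trans additive-0v (sym (false· (f x))))
  additive-· true  x = trans (cong f (true· x)) (sym (true· (f x)))

  additive-lincomb : ∀ {k} (c : Vec Bool k) (b : Fin k → V m) →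
    f (lincomb c b) ≡ lincomb c (f ∘ b)
  additive-lincomb []       b = additive-0v
  additive-lincomb (c ∷ cs) b =
    trans (f-⊕ (c · b zero) (lincomb cs (b ∘ suc)))
          (cong₂ _⊕_ (additive-· c (b zero)) (additive-lincomb cs (b ∘ suc)))

-- Combinations of `b` are closed under `_⊕_` by adding coefficient vectors, so only the generators
-- need to be expressed.
span⇒lincomb : ∀ {n k} {P : V n → Set} {b : Fin k → V n} →
  (∀ w → P w → ∃ λ c → w ≡ lincomb c b) →
  ∀ w → Span P w → ∃ λ c → w ≡ lincomb c b
span⇒lincomb {b = b} P⇒ w ([] , [] , refl) = 0v , sym (lincomb-0v b)
span⇒lincomb {b = b} P⇒ w (x ∷ xs , px ∷ pxs , refl)
  with c , refl ← P⇒ x px | d , eq ← span⇒lincomb P⇒ (sumL xs) (xs , pxs , refl) =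
  c ⊕ d , trans (cong (lincomb c b ⊕_) eq) (sym (lincomb-⊕ c d b))

lincomb⇒span : ∀ {n k} {P : V n → Set} {b : Fin k → V n} → (∀ i → P (b i)) →
  (c : Vec Bool k) → Span P (lincomb c b)
lincomb⇒span Pb [] = [] , [] , refl
lincomb⇒span {P = P} {b} Pb (false ∷ cs)
  with xs , pxs , eq ← lincomb⇒span {P = P} {b ∘ suc} (Pb ∘ suc) cs =
  xs , pxs , trans (cong₂ _⊕_ (false· (b zero)) eq) (⊕-identityˡ (sumL xs))
lincomb⇒span {P = P} {b} Pb (true ∷ cs)
  with xs , pxs , eq ← lincomb⇒span {P = P} {b ∘ suc} (Pb ∘ suc) cs =
  b zero ∷ xs , Pb zero ∷ pxs , cong₂ _⊕_ (true· (b zero)) eq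

-- With the basis chosen inside `P`, only points of `P`, rather than arbitrary sums of them, remain
-- to be expressed.
spanHasDim : ∀ {n k} {P : V n → Set} (b : Fin k → V n) → LinIndep b →
  (∀ i → P (b i)) → (∀ w → P w → ∃ λ c → w ≡ lincomb c b) → SpanHasDim P k
spanHasDim b indep Pb P⇒ =
  b , indep , λ w → span⇒lincomb P⇒ w , λ { (c , refl) → lincomb⇒span Pb c }

-- The group of the A λ

record Automorphism (f : V8 → V8) : Set where
  field
    additive : Additive f
    kernel   : ∀ x → f x ≡ 0v → x ≡ 0v

open Automorphism

id-automorphism : Automorphism id
id-automorphism = record { additive = λ _ _ → refl ; kernel = λ _ eq → eq }

∘-automorphism : ∀ {f g} → Automorphism f → Automorphism g → Automorphism (f ∘ g)
∘-automorphism {f} {g} F G = record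
  { additive = λ x y → trans (cong f (additive G x y)) (additive F (g x) (g y))
  ; kernel   = λ x → kernel G x ∘ kernel F (g x)
  }

iter-automorphism : ∀ {f} n → Automorphism f → Automorphism (iter n f)
iter-automorphism zero    F = id-automorphism
iter-automorphism (suc n) F = ∘-automorphism F (iter-automorphism n F)

order3-automorphism : ∀ {img} → (∀ x → iter 3 (linExt img) x ≡ x) → Automorphism (linExt img)
order3-automorphism {img} cube = record { additive = add ; kernel = ker }
  where
  f = linExt img

  add : Additive f
  add x y = lincomb-⊕ x y img

  ker : ∀ x → f x ≡ 0v → x ≡ 0v
  ker x fx≡0 = begin
    x            ≡⟨ cube x ⟨
    f (f (f x))  ≡⟨ cong (f ∘ f) fx≡0 ⟩
    f (f 0v)     ≡⟨ cong f (additive-0v add) ⟩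
    f 0v         ≡⟨ additive-0v add ⟩
    0v           ∎

ζa-automorphism : Automorphism ζa
ζa-automorphism = order3-automorphism (toWitness {a? = allV? 8 λ x → iter 3 ζa x ≟V x} _)

ζb-automorphism : Automorphism ζb
ζb-automorphism = order3-automorphism (toWitness {a? = allV? 8 λ x → iter 3 ζb x ≟V x} _)

ζc-automorphism : Automorphism ζc
ζc-automorphism = order3-automorphism (toWitness {a? = allV? 8 λ x → iter 3 ζc x ≟V x} _)

ζd-automorphism : Automorphism ζd
ζd-automorphism = order3-automorphism (toWitness {a? = allV? 8 λ x → iter 3 ζd x ≟V x} _)

A-automorphism : ∀ μ → Automorphism (A μ)
A-automorphism (i ∷ j ∷ k ∷ l ∷ []) =
  ∘-automorphism (iter-automorphism (toℕ i) ζa-automorphism)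
  (∘-automorphism (iter-automorphism (toℕ j) ζb-automorphism)
  (∘-automorphism (iter-automorphism (toℕ k) ζc-automorphism)
                  (iter-automorphism (toℕ l) ζd-automorphism)))

-- The seven points for the hyperplane λᵢ = 0

-- `remQuot {3} 2` reads an index below 6 as a pair: `j` selects one of the three coordinates other
-- than `i`, and `suc t` is the exponent 1 or 2 there.
axisExponent : Fin 4 → Fin 7 → F3⁴
axisExponent i zero    = 0₃
axisExponent i (suc k) = let j , t = remQuot {3} 2 k in suc t *v ε (punchIn i j)

axisPoint : Fin 4 → Fin 7 → V8
axisPoint i k = A (axisExponent i k) u

-- In a block other than the `i`-th, the two moved points differ from `u` by two distinct nonzero
-- vectors of that block, hence by a basis of it. These six differences vanish on block `i`, where
-- `u` does not.
axisPoint-indep : ∀ i → LinIndep (axisPoint i)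
axisPoint-indep = toWitness {a? = all? λ i → allV? 7 λ c →
  (lincomb c (axisPoint i) ≟V 0v) →-dec (c ≟V 0v)} _

-- The coefficient of u makes the number of nonzero coefficients odd.
axisCoeffs : Fin 4 → F3⁴ → Vec Bool 7
axisCoeffs i λ' = foldr′ _xor_ true cs ∷ cs
  where
  cs : Vec Bool 6
  cs = tabulate λ k → let j , t = remQuot {3} 2 k in does (lookup λ' (punchIn i j) ≟ suc t)

-- For each block moved by `λ'`, the indicator selects the axis point with the same exponent there.
-- The copies of `u` that the points carry on other blocks cancel in pairs, leaving one exactly on
-- the unmoved blocks.
A-u-lincomb : ∀ i λ' → lookup λ' i ≡ zero → A λ' u ≡ lincomb (axisCoeffs i λ') (axisPoint i)
A-u-lincomb = toWitness {a? = all? λ i → allF3⁴? λ λ' →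
  (lookup λ' i ≟ zero) →-dec (A λ' u ≟V lincomb (axisCoeffs i λ') (axisPoint i))} _

-- Subspaces of F₃⁴

+v-interchange : Interchangable _≡_ _+v_ _+v_
+v-interchange = zipWith-interchange
  (toWitness {a? = all? λ w → all? λ x → all? λ y → all? λ z →
                     ((w +₃ x) +₃ (y +₃ z)) ≟ ((w +₃ y) +₃ (x +₃ z))} _)

zero-*v : ∀ x → zero *v x ≡ 0₃
zero-*v = toWitness {a? = allF3⁴? λ x → (zero *v x) ≟F3⁴ 0₃} _

+₃-*v : ∀ a b x → (a +₃ b) *v x ≡ (a *v x) +v (b *v x)
+₃-*v = toWitness {a? = all? λ a → all? λ b → allF3⁴? λ x →
  ((a +₃ b) *v x) ≟F3⁴ ((a *v x) +v (b *v x))} _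

*₃-*v : ∀ a b x → (a *₃ b) *v x ≡ a *v (b *v x)
*₃-*v = toWitness {a? = all? λ a → all? λ b → allF3⁴? λ x →
  ((a *₃ b) *v x) ≟F3⁴ (a *v (b *v x))} _

*₃-distribˡ-+₃ : ∀ a x y → a *₃ (x +₃ y) ≡ (a *₃ x) +₃ (a *₃ y)
*₃-distribˡ-+₃ = toWitness {a? = all? λ a → all? λ x → all? λ y →
  (a *₃ (x +₃ y)) ≟ ((a *₃ x) +₃ (a *₃ y))} _

-- Argued by coordinates: a search over both vectors would meet 3 · 81 · 81 cases.
*v-+v : ∀ a x y → a *v (x +v y) ≡ (a *v x) +v (a *v y)
*v-+v a (x₁ ∷ x₂ ∷ x₃ ∷ x₄ ∷ []) (y₁ ∷ y₂ ∷ y₃ ∷ y₄ ∷ []) =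
  cong₂ _∷_ (*₃-distribˡ-+₃ a x₁ y₁) (cong₂ _∷_ (*₃-distribˡ-+₃ a x₂ y₂)
  (cong₂ _∷_ (*₃-distribˡ-+₃ a x₃ y₃) (cong (_∷ []) (*₃-distribˡ-+₃ a x₄ y₄))))

record IsSubspace (W : F3⁴ → Set) : Set where
  field
    +-closed : ∀ {x y} → W x → W y → W (x +v y)
    *-closed : ∀ a {x} → W x → W (a *v x)

SpanF3-isSubspace : ∀ v₁ v₂ v₃ → IsSubspace (SpanF3 v₁ v₂ v₃)
SpanF3-isSubspace v₁ v₂ v₃ = record { +-closed = add ; *-closed = scale }
  where
  W = SpanF3 v₁ v₂ v₃

  add : ∀ {x y} → W x → W y → W (x +v y)
  add (a , b , c , refl) (a' , b' , c' , refl) = a +₃ a' , b +₃ b' , c +₃ c' , (begin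
    ((a *v v₁) +v ((b *v v₂) +v (c *v v₃))) +v ((a' *v v₁) +v ((b' *v v₂) +v (c' *v v₃)))
      ≡⟨ +v-interchange (a *v v₁) _ (a' *v v₁) _ ⟩
    ((a *v v₁) +v (a' *v v₁)) +v (((b *v v₂) +v (c *v v₃)) +v ((b' *v v₂) +v (c' *v v₃)))
      ≡⟨ cong (_ +v_) (+v-interchange (b *v v₂) _ (b' *v v₂) _) ⟩
    ((a *v v₁) +v (a' *v v₁)) +v (((b *v v₂) +v (b' *v v₂)) +v ((c *v v₃) +v (c' *v v₃)))
      ≡⟨ cong₂ _+v_ (+₃-*v a a' v₁) (cong₂ _+v_ (+₃-*v b b' v₂) (+₃-*v c c' v₃)) ⟨
    ((a +₃ a') *v v₁) +v (((b +₃ b') *v v₂) +v ((c +₃ c') *v v₃)) ∎)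

  scale : ∀ t {x} → W x → W (t *v x)
  scale t (a , b , c , refl) = t *₃ a , t *₃ b , t *₃ c , (begin
    t *v ((a *v v₁) +v ((b *v v₂) +v (c *v v₃)))
      ≡⟨ *v-+v t (a *v v₁) _ ⟩
    (t *v (a *v v₁)) +v (t *v ((b *v v₂) +v (c *v v₃)))
      ≡⟨ cong (_ +v_) (*v-+v t (b *v v₂) _) ⟩
    (t *v (a *v v₁)) +v ((t *v (b *v v₂)) +v (t *v (c *v v₃)))
      ≡⟨ cong₂ _+v_ (*₃-*v t a v₁) (cong₂ _+v_ (*₃-*v t b v₂) (*₃-*v t c v₃)) ⟨
    ((t *₃ a) *v v₁) +v (((t *₃ b) *v v₂) +v ((t *₃ c) *v v₃)) ∎)

-₃_ : F3 → F3
-₃ x = suc (suc zero) *₃ x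

offAxis : Fin 4 → F3⁴ → Fin 3 → F3⁴
offAxis i x j = (-₃ lookup x (punchIn i j)) *v ε (punchIn i j)

-- Each off-axis term cancels one coordinate of `x` other than the `i`-th.
coordinate-split : ∀ i x →
  ((x +v offAxis i x zero) +v offAxis i x (suc zero)) +v offAxis i x (suc (suc zero))
    ≡ lookup x i *v ε i
coordinate-split = toWitness {a? = all? λ i → allF3⁴? λ x →
  (((x +v offAxis i x zero) +v offAxis i x (suc zero)) +v offAxis i x (suc (suc zero)))
    ≟F3⁴ (lookup x i *v ε i)} _

-- A nonzero element of F₃ is its own inverse.
square-*v-ε : ∀ s i → s ≢ zero → s *v (s *v ε i) ≡ ε i
square-*v-ε s i s≢0 = fromInj₂ (flip contradiction s≢0) (zero-or-square s i)
  where
  zero-or-square : ∀ s i → s ≡ zero ⊎ s *v (s *v ε i) ≡ ε i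
  zero-or-square = toWitness {a? = all? λ s → all? λ i →
    (s ≟ zero) ⊎-dec ((s *v (s *v ε i)) ≟F3⁴ ε i)} _

-- The coordinate hyperplane and its cosets

module _ {W : F3⁴ → Set} (W-sub : IsSubspace W)
         (i : Fin 4) (εi∉W : ¬ W (ε i))
         (εj∈W : ∀ j → j ≢ i → W (ε j)) where

  open IsSubspace W-sub

  ∈W⇒coordinate≡0 : ∀ x → W x → lookup x i ≡ zero
  ∈W⇒coordinate≡0 x x∈W with lookup x i ≟ zero
  ... | yes xᵢ≡0 = xᵢ≡0
  ... | no  xᵢ≢0 = contradiction
    -- Clearing the other coordinates keeps `x` in `W` and leaves a nonzero multiple of `ε i`;
    -- rescaling it would put `ε i` itself in `W`.
    (subst W (square-*v-ε (lookup x i) i xᵢ≢0)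
      (*-closed (lookup x i)
        (subst W (coordinate-split i x)
          (+-closed (+-closed (+-closed x∈W (off zero)) (off (suc zero))) (off (suc (suc zero)))))))
    εi∉W
    where
    off : ∀ j → W (offAxis i x j)
    off j = *-closed (-₃ lookup x (punchIn i j)) (εj∈W (punchIn i j) (punchInᵢ≢i i j))

  axisExponent∈W : ∀ k → W (axisExponent i k)
  axisExponent∈W zero    =
    -- The zero vector is obtained as the zero multiple of a standard point in `W`; any `j` other
    -- than `i` would do.
    subst W (zero-*v _) (*-closed zero (εj∈W (punchIn i zero) (punchInᵢ≢i i zero)))
  axisExponent∈W (suc k) = let j , t = remQuot {3} 2 k in
    *-closed (suc t) (εj∈W (punchIn i j) (punchInᵢ≢i i j))

  RCoset-isHyperplane : ∀ μ → IsProjFlat (RCoset W μ) 6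
  RCoset-isHyperplane μ = spanHasDim (A μ ∘ axisPoint i) indep
    (λ k → axisExponent i k , axisExponent∈W k , refl)
    -- The coefficients found for μ = 0 serve every coset, because `A μ` preserves linear
    -- combinations.
    (λ { w (λ' , λ'∈W , refl) → axisCoeffs i λ' ,
         trans (cong (A μ) (A-u-lincomb i λ' (∈W⇒coordinate≡0 λ' λ'∈W)))
               (A-lincomb (axisCoeffs i λ')) })
    where
    A-lincomb : ∀ c → A μ (lincomb c (axisPoint i)) ≡ lincomb c (A μ ∘ axisPoint i)
    A-lincomb c = additive-lincomb (additive (A-automorphism μ)) c (axisPoint i)

    indep : LinIndep (A μ ∘ axisPoint i)
    indep c eq = axisPoint-indep i c
      (kernel (A-automorphism μ) _ (trans (A-lincomb c) eq))

theorem8 : (v₁ v₂ v₃ : F3⁴) → Indep3 v₁ v₂ v₃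
    → ExactlyThreeStdPoints (SpanF3 v₁ v₂ v₃)
    → (μ : F3⁴)
    → IsProjFlat (RCoset (SpanF3 v₁ v₂ v₃) μ) 6
theorem8 v₁ v₂ v₃ _ (i , εi∉W , εj∈W) =
  RCoset-isHyperplane (SpanF3-isSubspace v₁ v₂ v₃) i εi∉W εj∈W
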